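{- Let $n_1,n_2,n_3$ be integers with $3\le n_1,n_2\le n_3$ and let $W$ be a basic landmark system for $K(\mathbf{n})$. Then $W$ is a resolving set of $K(\mathbf{n})$ if and only if the landmark graph $\mathcal{G}(W)$ contains no bad $4$-cycle, no plain hex, and no shark teeth.
   Context: $K(\mathbf{n})=K_{n_1}\times K_{n_2}\times K_{n_3}$ is the direct product of complete graphs: its vertices are the triples $(x_1,x_2,x_3)$ with $1\le x_i\le n_i$, and two vertices are adjacent iff they differ in every coordinate. $d$ denotes graph distance. A set $W$ of vertices is resolving if for every two distinct vertices $x,y\notin W$ there is $w\in W$ with $d(x,w)\ne d(y,w)$. Landmark graph: for $W$ a set of vertices, let $W_{i,a}=\{w\in W: w_i=a\}$. The landmark graph $\mathcal{G}(W)$ is the hypergraph with vertex set $W$ whose hyperedges are the nonempty sets $W_{i,a}$ ($W_{i,a}$ has color $i$). A hyperedge with exactly two vertices is a stick, with at least three vertices poofy. Basic landmark system: $W$ such that (1) $W_{i,a}\neq\emptyset$ for all $i\in\{1,2,3\}$, $1\le a\le n_i$; (2) $|W_{i,a}|\ge 2$ for all such $i,a$; (3) $|W_{i,a}\cap W_{j,b}|\le 1$ whenever $i\ne j$. Bad $4$-cycle: distinct $w_1,w_2,w_3,w_4\in W$ and $\{i,j,k\}=\{1,2,3\}$ such that $\{w_1,w_2\}$ and $\{w_3,w_4\}$ are both hyperedges of color $i$, $w_2,w_3$ lie in a common hyperedge of color $j$, and $w_4,w_1$ lie in a common hyperedge of color $k$. Plain hex: distinct $w_1,\dots,w_6\in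 W$ and an ordering $(i,j,k)$ of $\{1,2,3\}$ such that $\{w_1,w_2\},\{w_4,w_5\}$ are hyperedges of color $i$, $\{w_2,w_3\},\{w_5,w_6\}$ are hyperedges of color $j$, and $\{w_3,w_4\},\{w_6,w_1\}$ are hyperedges of color $k$. Rainbow $2$-$2$-triangle: distinct $w_1,w_2,w_3\in W$ and $\{i,j,k\}=\{1,2,3\}$ such that $\{w_1,w_2\}$ is a hyperedge of color $i$, $\{w_2,w_3\}$ is a hyperedge of color $j$, and $w_1,w_3$ (the termini) lie in a common hyperedge of color $k$. Shark teeth: two rainbow $2$-$2$-triangles with the same colors $i,j,k$ on disjoint vertex sets whose four termini all belong to the same poofy hyperedge of color $k$. -}

module Defs where

open import Data.Bool using (Bool; T; _∧_; _∨_)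
open import Data.Fin using (Fin)
open import Data.Fin.Patterns using (0F; 1F; 2F)
import Data.Fin.Properties as Fin
open import Data.List using (List; []; _∷_; length; filterᵇ; allFin; cartesianProduct)
open import Data.List.Relation.Unary.All using (All)
open import Data.List.Relation.Unary.Unique.Propositional using (Unique)
open import Data.List.Relation.Binary.Disjoint.Propositional using (Disjoint)
open import Data.Nat using (ℕ; zero; suc; _≤_)
open import Data.Product using (_×_; _,_; ∃-syntax)
open import Data.Product.Properties using (≡-dec)
open import Relation.Binary using (Rel; DecidableEquality)
open import Relation.Binary.PropositionalEquality using (_≢_; _≗_)
open import Relation.Nullary using (¬_; does)
open import Level using (0ℓ)

data Walk {A : Set} (_~_ : Rel A 0ℓ) : ℕ → A → A → Set where
  stop : ∀ {x} → Walk _~_ zero x x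
  step : ∀ {k x y z} → x ~ y → Walk _~_ k y z → Walk _~_ (suc k) x z

IsDistance : {A : Set} → Rel A 0ℓ → A → A → ℕ → Set
IsDistance _~_ x y k = Walk _~_ k x y × (∀ m → Walk _~_ m x y → k ≤ m)

-- The colors / coordinate indices 1, 2, 3 of the mathematics are 0F, 1F, 2F,
-- and the coordinate values 1, …, nᵢ are the elements of Fin (n i).
Color : Set
Color = Fin 3

AllColors : Color → Color → Color → Set
AllColors i j k = i ≢ j × j ≢ k × i ≢ k

module LandmarkSystems (n : Color → ℕ) where

  Vertex : Set
  Vertex = Fin (n 0F) × Fin (n 1F) × Fin (n 2F)

  VertexSet : Set
  VertexSet = Vertex → Bool

  coord : (i : Color) → Vertex → Fin (n i)
  coord 0F (a , _ , _) = a
  coord 1F (_ , b , _) = b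
  coord 2F (_ , _ , c) = c

  _≟ᵛ_ : DecidableEquality Vertex
  _≟ᵛ_ = ≡-dec Fin._≟_ (≡-dec Fin._≟_ Fin._≟_)

  Adjacent : Rel Vertex 0ℓ
  Adjacent x y = ∀ i → coord i x ≢ coord i y

  infix 4 _∈_ _∉_

  _∈_ _∉_ : Vertex → VertexSet → Set
  v ∈ S = T (S v)
  v ∉ S = ¬ (v ∈ S)

  Nonempty : VertexSet → Set
  Nonempty S = ∃[ v ] v ∈ S

  infixr 7 _∩_

  _∩_ : VertexSet → VertexSet → VertexSet
  (S ∩ S′) v = S v ∧ S′ v

  pair : Vertex → Vertex → VertexSet
  pair u v w = does (w ≟ᵛ u) ∨ does (w ≟ᵛ v)

  allVertices : List Vertex
  allVertices = cartesianProduct (allFin (n 0F)) (cartesianProduct (allFin (n 1F)) (allFin (n 2F)))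

  card : VertexSet → ℕ
  card S = length (filterᵇ S allVertices)

  -- d(x,w) ≠ d(y,w).  For n i ≥ 3 the graph is connected, so both distances are finite.
  Resolves : Vertex → Vertex → Vertex → Set
  Resolves w x y =
    ∃[ k ] ∃[ l ] (IsDistance Adjacent x w k × IsDistance Adjacent y w l × k ≢ l)

  IsResolving : VertexSet → Set
  IsResolving W = ∀ x y → x ≢ y → x ∉ W → y ∉ W → ∃[ w ] (w ∈ W × Resolves w x y)

  -- The set W_{i,a}.
  slice : VertexSet → (i : Color) → Fin (n i) → VertexSet
  slice W i a w = W w ∧ does (coord i w Fin.≟ a)

  record IsBasicLandmarkSystem (W : VertexSet) : Set where
    field
      nonempty     : ∀ i a → Nonempty (slice W i a)
      at-least-two : ∀ i a → 2 ≤ card (slice W i a)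
      at-most-one  : ∀ i j a b → i ≢ j → card (slice W i a ∩ slice W j b) ≤ 1

  record ColoredHypergraph : Set₁ where
    field
      vertices  : VertexSet
      Hyperedge : Color → VertexSet → Set

  landmarkGraph : VertexSet → ColoredHypergraph
  landmarkGraph W = record
    { vertices  = W
    ; Hyperedge = λ i E → Nonempty E × ∃[ a ] E ≗ slice W i a
    }

  Poofy : VertexSet → Set
  Poofy E = 3 ≤ card E

  module _ (G : ColoredHypergraph) where
    open ColoredHypergraph G

    InCommonHyperedge : Color → Vertex → Vertex → Set
    InCommonHyperedge i u v = ∃[ E ] (Hyperedge i E × u ∈ E × v ∈ E)

    DistinctVertices : List Vertex → Set
    DistinctVertices ws = Unique ws × All (_∈ vertices) ws

    record BadFourCycle : Set where
      field
        {i j k}       : Color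
        {w₁ w₂ w₃ w₄} : Vertex
        colors        : AllColors i j k
        distinct      : DistinctVertices (w₁ ∷ w₂ ∷ w₃ ∷ w₄ ∷ [])
        edge₁₂        : Hyperedge i (pair w₁ w₂)
        edge₃₄        : Hyperedge i (pair w₃ w₄)
        common₂₃      : InCommonHyperedge j w₂ w₃
        common₄₁      : InCommonHyperedge k w₄ w₁

    record PlainHex : Set where
      field
        {i j k}             : Color
        {w₁ w₂ w₃ w₄ w₅ w₆} : Vertex
        colors              : AllColors i j k
        distinct            : DistinctVertices (w₁ ∷ w₂ ∷ w₃ ∷ w₄ ∷ w₅ ∷ w₆ ∷ [])
        edge₁₂              : Hyperedge i (pair w₁ w₂)
        edge₄₅              : Hyperedge i (pair w₄ w₅)
        edge₂₃              : Hyperedge j (pair w₂ w₃)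
        edge₅₆              : Hyperedge j (pair w₅ w₆)
        edge₃₄              : Hyperedge k (pair w₃ w₄)
        edge₆₁              : Hyperedge k (pair w₆ w₁)

    -- The termini are w₁ and w₃.
    record Rainbow22Triangle (i j k : Color) (w₁ w₂ w₃ : Vertex) : Set where
      field
        colors   : AllColors i j k
        distinct : DistinctVertices (w₁ ∷ w₂ ∷ w₃ ∷ [])
        edge₁₂   : Hyperedge i (pair w₁ w₂)
        edge₂₃   : Hyperedge j (pair w₂ w₃)
        common₁₃ : InCommonHyperedge k w₁ w₃

    record SharkTeeth : Set where
      field
        {i j k}    : Color
        {u₁ u₂ u₃} : Vertex
        {v₁ v₂ v₃} : Vertex
        triangle-u : Rainbow22Triangle i j k u₁ u₂ u₃
        triangle-v : Rainbow22Triangle i j k v₁ v₂ v₃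
        disjoint   : Disjoint (u₁ ∷ u₂ ∷ u₃ ∷ []) (v₁ ∷ v₂ ∷ v₃ ∷ [])
        {E}        : VertexSet
        hyperedge  : Hyperedge k E
        poofy      : Poofy E
        termini    : All (_∈ E) (u₁ ∷ u₃ ∷ v₁ ∷ v₃ ∷ [])

{-# OPTIONS --safe #-}

-- A vertex x ∉ W has distance 2 from the landmarks sharing a coordinate with x and distance 1
-- from all others, so W resolves x and y unless the same landmarks share a coordinate with x as
-- with y.  In that case, if x and y differ in coordinate i, the color-i hyperedge at x is covered
-- by the hyperedges of the other two colors at y; as hyperedges of different colors meet at most
-- once, it is a stick with one vertex in each.  Gluing these sticks gives a bad 4-cycle, shark
-- teeth or a plain hex, according to whether x and y differ in one, two or three coordinates.
module Submission where

open import Defs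
open import Data.Bool using (T; T?)
open import Data.Bool.Properties using (T-∧; T-∨)
open import Data.Empty using (⊥-elim)
open import Data.Fin using (Fin; suc)
open import Data.Fin.Patterns using (0F; 1F; 2F)
open import Data.Fin.Properties using (_≟_; all?; any?)
open import Data.List using (List; []; _∷_; _++_; length; filterᵇ)
open import Data.List.Properties using (length-++-sucʳ)
import Data.List.Membership.Propositional as List
open import Data.List.Membership.Propositional.Properties using (∈-∃++; ∈-++⁺ˡ; ∈-++⁺ʳ; ∈-++⁻; ∈-allFin; ∈-cartesianProduct⁺; ∈-filter⁺; ∈-filter⁻)
open import Data.List.Relation.Binary.Disjoint.Propositional using (Disjoint)
open import Data.List.Relation.Unary.All using (All; []; _∷_)
import Data.List.Relation.Unary.All as All
open import Data.List.Relation.Unary.AllPairs using ([]; _∷_)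
open import Data.List.Relation.Unary.Any using (here; there)
open import Data.List.Relation.Unary.Unique.Propositional using (Unique)
open import Data.List.Relation.Unary.Unique.Propositional.Properties using (allFin⁺; cartesianProduct⁺; filter⁺)
open import Data.Nat using (ℕ; zero; suc; _≤_; z≤n; s≤s)
open import Data.Nat.Properties using (≤-antisym; ≤-trans; 1+n≰n; module ≤-Reasoning)
open import Data.Product using (_×_; _,_; ∃-syntax; proj₁; proj₂)
open import Data.Sum using (_⊎_; inj₁; inj₂; [_,_]; swap)
open import Function using (_∘_)
open import Function.Bundles using (_⇔_; mk⇔; Equivalence)
open import Relation.Binary.PropositionalEquality using (_≡_; _≢_; refl; sym; trans; cong; cong₂; subst; ≢-sym)
open import Relation.Nullary using (¬_; Dec; yes; no; does; contradiction)
open import Relation.Nullary.Decidable using (¬?; _×-dec_; _⊎-dec_; _→-dec_; map′; from-yes; dec-true; does-⇔; decidable-stable)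

-- Booleans, lists without repetition, and permutations of the colors.

private
  variable
    A : Set
    i j k : Color

T-ext : ∀ {a b} → (T a → T b) → (T b → T a) → a ≡ b
T-ext {a} {b} to from = does-⇔ (mk⇔ to from) (T? a) (T? b)

T-does⁺ : {P : Set} (P? : Dec P) → P → T (does P?)
T-does⁺ P? p rewrite dec-true P? p = _

T-does⁻ : {P : Set} (P? : Dec P) → T (does P?) → P
T-does⁻ (yes p) _ = p

-- Induction on `us`: one occurrence of the head is cut out of `xs`, and since the head does not
-- recur in `us`, the remaining elements still lie in what is left.
unique-⊆⇒length-≤ : {us xs : List A} → Unique us → (∀ {u} → u List.∈ us → u List.∈ xs) → length us ≤ length xs
unique-⊆⇒length-≤ [] us⊆xs = z≤n
unique-⊆⇒length-≤ {us = u ∷ us} (u∉us ∷ us!) us⊆xs with ∈-∃++ (us⊆xs (here refl))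
... | ys , zs , refl = begin
  suc (length us)          ≤⟨ s≤s (unique-⊆⇒length-≤ us! us⊆ys++zs) ⟩
  suc (length (ys ++ zs))  ≡⟨ length-++-sucʳ ys u zs ⟨
  length (ys ++ u ∷ zs)    ∎
  where
  open ≤-Reasoning
  us⊆ys++zs : ∀ {v} → v List.∈ us → v List.∈ ys ++ zs
  us⊆ys++zs v∈us with ∈-++⁻ ys (us⊆xs (there v∈us))
  ... | inj₁ v∈ys           = ∈-++⁺ˡ v∈ys
  ... | inj₂ (here v≡u)     = contradiction (sym v≡u) (All.lookup u∉us v∈us)
  ... | inj₂ (there v∈zs)   = ∈-++⁺ʳ ys v∈zs

unique-two : {xs : List A} → Unique xs → 2 ≤ length xs → ∃[ u ] ∃[ v ] (u ≢ v × u List.∈ xs × v List.∈ xs)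
unique-two {xs = _ ∷ []} _ (s≤s ())
unique-two {xs = u ∷ v ∷ _} ((u≢v ∷ _) ∷ _) _ = u , v , u≢v , here refl , there (here refl)

All≢⇒Disjoint : {us vs : List A} → All (λ u → All (u ≢_) vs) us → Disjoint us vs
All≢⇒Disjoint us≢vs (v∈us , v∈vs) = All.lookup (All.lookup us≢vs v∈us) v∈vs refl

-- Applied in every coordinate, this yields a common neighbor of two vertices.
avoid-two : ∀ {m} → 3 ≤ m → (a b : Fin m) → ∃[ c ] (a ≢ c × b ≢ c)
avoid-two (s≤s (s≤s (s≤s _))) 0F            0F            = 1F , (λ ()) , (λ ())
avoid-two (s≤s (s≤s (s≤s _))) 0F            1F            = 2F , (λ ()) , (λ ())
avoid-two (s≤s (s≤s (s≤s _))) 0F            (suc (suc _)) = 1F , (λ ()) , (λ ())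
avoid-two (s≤s (s≤s (s≤s _))) 1F            0F            = 2F , (λ ()) , (λ ())
avoid-two (s≤s (s≤s (s≤s _))) (suc (suc _)) 0F            = 1F , (λ ()) , (λ ())
avoid-two (s≤s (s≤s (s≤s _))) (suc _)       (suc _)       = 0F , (λ ()) , (λ ())

abstract
  -- There are only 81 color quadruples, so a decision procedure settles the claim by evaluation.
  -- `abstract` keeps that evaluation from unfolding in later case splits.
  color-cases : AllColors i j k → ∀ l → l ≡ i ⊎ l ≡ j ⊎ l ≡ k
  color-cases {i} {j} {k} colors l = from-yes exhaustive? i j k l colors
    where
    exhaustive? : Dec (∀ i j k l → AllColors i j k → l ≡ i ⊎ l ≡ j ⊎ l ≡ k)
    exhaustive? = all? λ i → all? λ j → all? λ k → all? λ l →
      (¬? (i ≟ j) ×-dec ¬? (j ≟ k) ×-dec ¬? (i ≟ k)) →-dec (l ≟ i ⊎-dec (l ≟ j ⊎-dec l ≟ k))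

rotate : AllColors i j k → AllColors j k i
rotate (i≢j , j≢k , i≢k) = j≢k , ≢-sym i≢k , ≢-sym i≢j

transpose : AllColors i j k → AllColors j i k
transpose (i≢j , j≢k , i≢k) = ≢-sym i≢j , i≢k , j≢k

-- Coordinates and distances in the product graph.

module Coordinates (n : Color → ℕ) where
  open LandmarkSystems n

  infix 4 _≈[_]_
  _≈[_]_ : Vertex → Color → Vertex → Set
  u ≈[ i ] v = coord i u ≡ coord i v

  Near : Vertex → Vertex → Set
  Near x w = ∃[ i ] x ≈[ i ] w

  near? : ∀ x w → Dec (Near x w)
  near? x w = any? λ i → coord i x ≟ coord i w

  any-vertex? : {P : Vertex → Set} → (∀ v → Dec (P v)) → Dec (∃[ v ] P v)
  any-vertex? P? = map′
    (λ (a , b , c , p) → (a , b , c) , p) (λ ((a , b , c) , p) → a , b , c , p)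
    (any? λ a → any? λ b → any? λ c → P? (a , b , c))

  vertex-ext : ∀ {u v} → (∀ l → u ≈[ l ] v) → u ≡ v
  vertex-ext u≈v = cong₂ _,_ (u≈v 0F) (cong₂ _,_ (u≈v 1F) (u≈v 2F))

  vertex-ext-colors : AllColors i j k → ∀ {u v} → u ≈[ i ] v → u ≈[ j ] v → u ≈[ k ] v → u ≡ v
  vertex-ext-colors {i} {j} {k} colors {u} {v} p q r = vertex-ext λ l → agree (color-cases colors l)
    where
    agree : ∀ {l} → l ≡ i ⊎ l ≡ j ⊎ l ≡ k → u ≈[ l ] v
    agree (inj₁ refl)        = p
    agree (inj₂ (inj₁ refl)) = q
    agree (inj₂ (inj₂ refl)) = r

  tabulate : (∀ l → Fin (n l)) → Vertex
  tabulate f = f 0F , f 1F , f 2F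

  coord-tabulate : ∀ f l → coord l (tabulate f) ≡ f l
  coord-tabulate f 0F = refl
  coord-tabulate f 1F = refl
  coord-tabulate f 2F = refl

  -- The colors are variables, so the triple cannot be written down directly; `source` selects, for
  -- each color, the vertex whose coordinate is copied.
  combine : AllColors i j k → ∀ u v w → ∃[ x ] (x ≈[ i ] u × x ≈[ j ] v × x ≈[ k ] w)
  combine {i} {j} {k} colors@(i≢j , j≢k , i≢k) u v w =
    tabulate (λ l → coord l (source l)) ,
    trans (coord-tabulate (λ l → coord l (source l)) i) (cong (coord i) (select-i (color-cases colors i))) ,
    trans (coord-tabulate (λ l → coord l (source l)) j) (cong (coord j) (select-j (color-cases colors j))) ,
    trans (coord-tabulate (λ l → coord l (source l)) k) (cong (coord k) (select-k (color-cases colors k)))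
    where
    select : ∀ {l} → l ≡ i ⊎ l ≡ j ⊎ l ≡ k → Vertex
    select (inj₁ _)        = u
    select (inj₂ (inj₁ _)) = v
    select (inj₂ (inj₂ _)) = w
    source : Color → Vertex
    source l = select (color-cases colors l)
    -- `color-cases` is opaque, so its answer at `i` is not known definitionally. All answers are
    -- treated, the wrong ones contradicting distinctness of the colors.
    select-i : ∀ c → select {i} c ≡ u
    select-i (inj₁ _)          = refl
    select-i (inj₂ (inj₁ i≡j)) = contradiction i≡j i≢j
    select-i (inj₂ (inj₂ i≡k)) = contradiction i≡k i≢k
    select-j : ∀ c → select {j} c ≡ v
    select-j (inj₁ j≡i)        = contradiction (sym j≡i) i≢j
    select-j (inj₂ (inj₁ _))   = refl
    select-j (inj₂ (inj₂ j≡k)) = contradiction j≡k j≢k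
    select-k : ∀ c → select {k} c ≡ w
    select-k (inj₁ k≡i)        = contradiction (sym k≡i) i≢k
    select-k (inj₂ (inj₁ k≡j)) = contradiction (sym k≡j) j≢k
    select-k (inj₂ (inj₂ _))   = refl

  distance-unique : ∀ {x w d e} → IsDistance Adjacent x w d → IsDistance Adjacent x w e → d ≡ e
  distance-unique (p , p-min) (q , q-min) = ≤-antisym (p-min _ q) (q-min _ p)

  far⇒distance-1 : ∀ {x w} → ¬ Near x w → IsDistance Adjacent x w 1
  far⇒distance-1 {x} {w} far = step (λ i p → far (i , p)) stop , minimal
    where
    minimal : ∀ m → Walk Adjacent m x w → 1 ≤ m
    minimal zero    stop = contradiction (0F , refl) far
    minimal (suc m) _    = s≤s z≤n

  -- A value avoiding both coordinates, taken in each color, gives a common neighbor `z`. The shared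
  -- coordinate excludes an edge, and `x ≢ w` excludes the empty walk.
  near⇒distance-2 : (∀ i → 3 ≤ n i) → ∀ {x w} → x ≢ w → Near x w → IsDistance Adjacent x w 2
  near⇒distance-2 n≥3 {x} {w} x≢w (i , x≈w) = step x-z (step z-w stop) , minimal
    where
    third : ∀ l → ∃[ c ] (coord l x ≢ c × coord l w ≢ c)
    third l = avoid-two (n≥3 l) (coord l x) (coord l w)
    z : Vertex
    z = tabulate (λ l → proj₁ (third l))
    z-third : ∀ l → coord l z ≡ proj₁ (third l)
    z-third = coord-tabulate (λ l → proj₁ (third l))
    x-z : Adjacent x z
    x-z l p = proj₁ (proj₂ (third l)) (trans p (z-third l))
    z-w : Adjacent z w
    z-w l p = proj₂ (proj₂ (third l)) (trans (sym p) (z-third l))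
    minimal : ∀ m → Walk Adjacent m x w → 2 ≤ m
    minimal zero          stop            = contradiction refl x≢w
    minimal (suc zero)    (step x-w stop) = contradiction x≈w (x-w i)
    minimal (suc (suc m)) _               = s≤s (s≤s z≤n)

  -- Cardinalities, and membership in slices and pairs.

  allVertices-unique : Unique allVertices
  allVertices-unique = cartesianProduct⁺ (allFin⁺ _) (cartesianProduct⁺ (allFin⁺ _) (allFin⁺ _))

  ∈⇒∈-filter : ∀ S {v} → v ∈ S → v List.∈ filterᵇ S allVertices
  ∈⇒∈-filter S {a , b , c} =
    ∈-filter⁺ (T? ∘ S) (∈-cartesianProduct⁺ (∈-allFin a) (∈-cartesianProduct⁺ (∈-allFin b) (∈-allFin c)))

  length≤card : ∀ S {us} → Unique us → All (_∈ S) us → length us ≤ card S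
  length≤card S us! us∈S = unique-⊆⇒length-≤ us! (λ u∈us → ∈⇒∈-filter S (All.lookup us∈S u∈us))

  card≤1⇒≡ : ∀ S {u v} → card S ≤ 1 → u ∈ S → v ∈ S → u ≡ v
  card≤1⇒≡ S {u} {v} S≤1 u∈S v∈S = decidable-stable (u ≟ᵛ v) λ u≢v →
    1+n≰n (≤-trans (length≤card S ((u≢v ∷ []) ∷ [] ∷ []) (u∈S ∷ v∈S ∷ [])) S≤1)

  2≤card⇒two : ∀ S → 2 ≤ card S → ∃[ u ] ∃[ v ] (u ≢ v × u ∈ S × v ∈ S)
  2≤card⇒two S 2≤S with unique-two (filter⁺ (T? ∘ S) allVertices-unique) 2≤S
  ... | u , v , u≢v , u∈ , v∈ =
    u , v , u≢v , proj₂ (∈-filter⁻ (T? ∘ S) {xs = allVertices} u∈) , proj₂ (∈-filter⁻ (T? ∘ S) {xs = allVertices} v∈)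

  ∈-slice⁺ : ∀ W i {a v} → v ∈ W → coord i v ≡ a → v ∈ slice W i a
  ∈-slice⁺ W i {a} {v} v∈W v-a = Equivalence.from T-∧ (v∈W , T-does⁺ (coord i v ≟ a) v-a)

  ∈-slice⁻ : ∀ W i {a v} → v ∈ slice W i a → v ∈ W × coord i v ≡ a
  ∈-slice⁻ W i {a} {v} v∈ with Equivalence.to T-∧ v∈
  ... | v∈W , v-a = v∈W , T-does⁻ (coord i v ≟ a) v-a

  ∈-pair⁺ : ∀ u v {w} → w ≡ u ⊎ w ≡ v → w ∈ pair u v
  ∈-pair⁺ u v {w} (inj₁ p) = Equivalence.from T-∨ (inj₁ (T-does⁺ (w ≟ᵛ u) p))
  ∈-pair⁺ u v {w} (inj₂ p) = Equivalence.from (T-∨ {does (w ≟ᵛ u)}) (inj₂ (T-does⁺ (w ≟ᵛ v) p))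

  ∈-pair⁻ : ∀ u v {w} → w ∈ pair u v → w ≡ u ⊎ w ≡ v
  ∈-pair⁻ u v {w} w∈ with Equivalence.to (T-∨ {does (w ≟ᵛ u)}) w∈
  ... | inj₁ p = inj₁ (T-does⁻ (w ≟ᵛ u) p)
  ... | inj₂ p = inj₂ (T-does⁻ (w ≟ᵛ v) p)

-- Slices and sticks of a landmark system.

module Landmarks (n : Color → ℕ) (n≥3 : ∀ i → 3 ≤ n i)
                 (W : LandmarkSystems.VertexSet n) (basic : LandmarkSystems.IsBasicLandmarkSystem n W) where
  open LandmarkSystems n
  open Coordinates n
  open IsBasicLandmarkSystem basic

  G : ColoredHypergraph
  G = landmarkGraph W

  open ColoredHypergraph G using (Hyperedge)

  private
    variable
      u v w x y : Vertex

  two-in-slice : ∀ i x → ∃[ u ] ∃[ v ] (u ≢ v × (u ∈ W × x ≈[ i ] u) × (v ∈ W × x ≈[ i ] v))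
  two-in-slice i x with 2≤card⇒two (slice W i (coord i x)) (at-least-two i (coord i x))
  ... | u , v , u≢v , u∈ , v∈ with ∈-slice⁻ W i u∈ | ∈-slice⁻ W i v∈
  ... | u∈W , u≈x | v∈W , v≈x = u , v , u≢v , (u∈W , sym u≈x) , (v∈W , sym v≈x)

  -- Condition (3) in the form used throughout: two coordinates determine a landmark.
  landmark-unique : i ≢ j → u ∈ W → v ∈ W → u ≈[ i ] v → u ≈[ j ] v → u ≡ v
  landmark-unique {i} {j} {u} {v} i≢j u∈W v∈W p q =
    card≤1⇒≡ (slice W i (coord i v) ∩ slice W j (coord j v)) (at-most-one i j _ _ i≢j)
      (Equivalence.from T-∧ (∈-slice⁺ W i u∈W p , ∈-slice⁺ W j u∈W q))
      (Equivalence.from T-∧ (∈-slice⁺ W i v∈W refl , ∈-slice⁺ W j v∈W refl))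

  -- Pointwise form of `pair u v` being a hyperedge of color `i`. Distinctness of the ends is not
  -- included and is carried separately.
  record Stick (i : Color) (u v : Vertex) : Set where
    constructor stick
    field
      left∈W  : u ∈ W
      right∈W : v ∈ W
      agree   : u ≈[ i ] v
      only    : ∀ {w} → w ∈ W → u ≈[ i ] w → w ≡ u ⊎ w ≡ v

  open Stick

  Stick-sym : Stick i u v → Stick i v u
  Stick-sym (stick u∈W v∈W u≈v only) = stick v∈W u∈W (sym u≈v) (λ w∈W v≈w → swap (only w∈W (trans u≈v v≈w)))

  slice-hyperedge : ∀ i → u ∈ W → Hyperedge i (slice W i (coord i u))
  slice-hyperedge {u} i u∈W = (u , ∈-slice⁺ W i u∈W refl) , coord i u , (λ _ → refl)

  Stick⇒Hyperedge : Stick i u v → Hyperedge i (pair u v)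
  Stick⇒Hyperedge {i} {u} {v} (stick u∈W v∈W u≈v only) =
    (u , ∈-pair⁺ u v (inj₁ refl)) , coord i u , λ w → T-ext (to ∘ ∈-pair⁻ u v) from
    where
    to : w ≡ u ⊎ w ≡ v → w ∈ slice W i (coord i u)
    to (inj₁ refl) = ∈-slice⁺ W i u∈W refl
    to (inj₂ refl) = ∈-slice⁺ W i v∈W (sym u≈v)
    from : w ∈ slice W i (coord i u) → w ∈ pair u v
    from w∈ with ∈-slice⁻ W i w∈
    ... | w∈W , w≈u = ∈-pair⁺ u v (only w∈W (sym w≈u))

  Hyperedge⇒Stick : Hyperedge i (pair u v) → Stick i u v
  Hyperedge⇒Stick {i} {u} {v} (_ , a , pair≗slice)
    with ∈-slice⁻ W i (subst T (pair≗slice u) (∈-pair⁺ u v (inj₁ refl)))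
       | ∈-slice⁻ W i (subst T (pair≗slice v) (∈-pair⁺ u v (inj₂ refl)))
  ... | u∈W , u-a | v∈W , v-a = stick u∈W v∈W (trans u-a (sym v-a)) λ {w} w∈W u≈w →
    ∈-pair⁻ u v (subst T (sym (pair≗slice w)) (∈-slice⁺ W i w∈W (trans (sym u≈w) u-a)))

  common⁺ : u ∈ W → v ∈ W → u ≈[ i ] v → InCommonHyperedge G i u v
  common⁺ {u} {v} {i} u∈W v∈W u≈v =
    slice W i (coord i u) , slice-hyperedge i u∈W , ∈-slice⁺ W i u∈W refl , ∈-slice⁺ W i v∈W (sym u≈v)

  hyperedge-agree : ∀ {E} → Hyperedge i E → u ∈ E → v ∈ E → u ≈[ i ] v
  hyperedge-agree {i} {u} {v} (_ , a , E≗slice) u∈E v∈E =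
    trans (proj₂ (∈-slice⁻ W i (subst T (E≗slice u) u∈E)))
          (sym (proj₂ (∈-slice⁻ W i (subst T (E≗slice v) v∈E))))

  common⁻ : InCommonHyperedge G i u v → u ≈[ i ] v
  common⁻ (_ , edge , u∈E , v∈E) = hyperedge-agree edge u∈E v∈E

  -- Failure to resolve as mutual nearness.

  infix 4 _⊑_
  _⊑_ : Vertex → Vertex → Set
  x ⊑ y = ∀ {w} → w ∈ W → Near x w → Near y w

  near-far⇒resolves : x ∉ W → y ∉ W → w ∈ W → Near x w → ¬ Near y w → Resolves w x y
  near-far⇒resolves x∉W y∉W w∈W x-w y-w =
    2 , 1 , near⇒distance-2 n≥3 (λ { refl → x∉W w∈W }) x-w , far⇒distance-1 y-w , λ ()

  Resolves-sym : Resolves w x y → Resolves w y x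
  Resolves-sym (d , e , x-d , y-e , d≢e) = e , d , y-e , x-d , ≢-sym d≢e

  separated? : ∀ x y → Dec (∃[ w ] (w ∈ W × Near x w × ¬ Near y w))
  separated? x y = any-vertex? λ w → T? (W w) ×-dec near? x w ×-dec ¬? (near? y w)

  unseparated⇒⊑ : ¬ (∃[ w ] (w ∈ W × Near x w × ¬ Near y w)) → x ⊑ y
  unseparated⇒⊑ {x} {y} none {w} w∈W x-w = decidable-stable (near? y w) λ y-w → none (w , w∈W , x-w , y-w)

  -- A landmark has to be exhibited, so the finite vertex set is searched for one near `x` and far
  -- from `y`, then for the reverse. Only if both searches fail is the hypothesis invoked.
  resolving : (∀ x y → x ≢ y → x ∉ W → y ∉ W → x ⊑ y → ¬ (y ⊑ x)) → IsResolving W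
  resolving distinguished x y x≢y x∉W y∉W with separated? x y | separated? y x
  ... | yes (w , w∈W , x-w , y-w) | _ = w , w∈W , near-far⇒resolves x∉W y∉W w∈W x-w y-w
  ... | no _ | yes (w , w∈W , y-w , x-w) = w , w∈W , Resolves-sym (near-far⇒resolves y∉W x∉W w∈W y-w x-w)
  ... | no none | no none′ =
    ⊥-elim (distinguished x y x≢y x∉W y∉W (unseparated⇒⊑ none) (unseparated⇒⊑ none′))

  -- Any landmark is near both vertices or near neither, so its two distances are both 2 or both 1.
  not-resolving : x ≢ y → x ∉ W → y ∉ W → x ⊑ y → y ⊑ x → ¬ IsResolving W
  not-resolving {x} {y} x≢y x∉W y∉W x⊑y y⊑x res with res x y x≢y x∉W y∉W
  ... | w , w∈W , d , e , x-d , y-e , d≢e with near? x w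
  ... | yes x-w = d≢e (trans
    (distance-unique x-d (near⇒distance-2 n≥3 (λ { refl → x∉W w∈W }) x-w))
    (distance-unique (near⇒distance-2 n≥3 (λ { refl → y∉W w∈W }) (x⊑y w∈W x-w)) y-e))
  ... | no ¬x-w = d≢e (trans
    (distance-unique x-d (far⇒distance-1 ¬x-w))
    (distance-unique (far⇒distance-1 (¬x-w ∘ y⊑x w∈W)) y-e))

  -- Configurations prevent resolving

  Covered : Color → Vertex → Vertex → Set
  Covered i x y = ∀ {w} → w ∈ W → x ≈[ i ] w → Near y w

  covered-agree : x ≈[ i ] y → Covered i x y
  covered-agree {i = i} x≈y w∈W x≈w = i , trans (sym x≈y) x≈w

  covered-stick : Stick i u v → x ≈[ i ] u → Near y u → Near y v → Covered i x y
  covered-stick s x≈u y-u y-v w∈W x≈w with only s w∈W (trans (sym x≈u) x≈w)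
  ... | inj₁ refl = y-u
  ... | inj₂ refl = y-v

  covered⇒⊑ : AllColors i j k → Covered i x y → Covered j x y → Covered k x y → x ⊑ y
  covered⇒⊑ colors ci cj ck w∈W (l , x≈w) with color-cases colors l
  ... | inj₁ refl        = ci w∈W x≈w
  ... | inj₂ (inj₁ refl) = cj w∈W x≈w
  ... | inj₂ (inj₂ refl) = ck w∈W x≈w

  stick-≢ : Stick i u v → w ∈ W → u ≢ w → v ≢ w → x ≈[ i ] u → y ≈[ i ] w → x ≢ y
  stick-≢ s w∈W u≢w v≢w x≈u y≈w refl =
    [ ≢-sym u≢w , ≢-sym v≢w ] (only s w∈W (trans (sym x≈u) y≈w))

  -- A landmark `x` in the slice of the stick would be `u` or `v`. Then `u` and `v` would agree in a
  -- second color: `j` if `x` is `u`, `k` if `x` is `v`.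
  stick-crossing-∉ : i ≢ j → i ≢ k → Stick i u v → u ≢ v → x ≈[ i ] u → x ≈[ j ] v → x ≈[ k ] u → x ∉ W
  stick-crossing-∉ i≢j i≢k s u≢v x≈u x≈v x≈u′ x∈W with only s x∈W (sym x≈u)
  ... | inj₁ refl = u≢v (landmark-unique i≢j (left∈W s) (right∈W s) (agree s) x≈v)
  ... | inj₂ refl = u≢v (landmark-unique i≢k (left∈W s) (right∈W s) (agree s) (sym x≈u′))

  -- A landmark `x` would be an end of both sticks.
  disjoint-sticks-∉ : ∀ {u′ v′} → Stick i u v → Stick j u′ v′ → u ≢ u′ → u ≢ v′ → v ≢ u′ → v ≢ v′ →
                      x ≈[ i ] u → x ≈[ j ] u′ → x ∉ W
  disjoint-sticks-∉ s t u≢u′ u≢v′ v≢u′ v≢v′ x≈u x≈u′ x∈W with only s x∈W (sym x≈u) | only t x∈W (sym x≈u′)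
  ... | inj₁ refl | inj₁ p = u≢u′ p
  ... | inj₁ refl | inj₂ p = u≢v′ p
  ... | inj₂ refl | inj₁ p = v≢u′ p
  ... | inj₂ refl | inj₂ p = v≢v′ p

  -- The unresolved pair differs in color `i` only, `x` taking it from `w₁` and `y` from `w₃`; both
  -- take `j` from `w₂` and `k` from `w₄`. The ends of either stick share `j` or `k` with the
  -- opposite vertex, through the common hyperedges.
  fourCycle⇒¬resolving : BadFourCycle G → ¬ IsResolving W
  fourCycle⇒¬resolving record
    { i = i ; j = j ; k = k ; w₁ = w₁ ; w₂ = w₂ ; w₃ = w₃ ; w₄ = w₄ ; colors = colors@(i≢j , j≢k , i≢k)
    ; distinct = ((w₁≢w₂ ∷ w₁≢w₃ ∷ _) ∷ (w₂≢w₃ ∷ _) ∷ (w₃≢w₄ ∷ []) ∷ _) , _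
    ; edge₁₂ = edge₁₂ ; edge₃₄ = edge₃₄ ; common₂₃ = common₂₃ ; common₄₁ = common₄₁ }
    with combine colors w₁ w₂ w₄ | combine colors w₃ w₂ w₄
  ... | x , xi , xj , xk | y , yi , yj , yk = not-resolving
    (stick-≢ s₁₂ (left∈W s₃₄) w₁≢w₃ w₂≢w₃ xi yi)
    (stick-crossing-∉ i≢j i≢k s₁₂ w₁≢w₂ xi xj (trans xk w₄≈w₁))
    (stick-crossing-∉ i≢k i≢j s₃₄ w₃≢w₄ yi yk (trans yj w₂≈w₃))
    (covered⇒⊑ colors (covered-stick s₁₂ xi (k , trans yk w₄≈w₁) (j , yj)) (covered-agree x≈ʲy) (covered-agree x≈ᵏy))
    (covered⇒⊑ colors (covered-stick s₃₄ yi (j , trans xj w₂≈w₃) (k , xk)) (covered-agree (sym x≈ʲy)) (covered-agree (sym x≈ᵏy)))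
    where
    s₁₂ = Hyperedge⇒Stick edge₁₂
    s₃₄ = Hyperedge⇒Stick edge₃₄
    w₂≈w₃ = common⁻ common₂₃
    w₄≈w₁ = common⁻ common₄₁
    x≈ʲy : x ≈[ j ] y
    x≈ʲy = trans xj (sym yj)
    x≈ᵏy : x ≈[ k ] y
    x≈ᵏy = trans xk (sym yk)

  -- The sides of the hexagon are alternately the slices at `x` and at `y`. Each corner lies on one
  -- side of either kind, hence is near both vertices.
  hex⇒¬resolving : PlainHex G → ¬ IsResolving W
  hex⇒¬resolving record
    { i = i ; j = j ; k = k ; w₁ = w₁ ; w₂ = w₂ ; w₃ = w₃ ; w₄ = w₄ ; w₅ = w₅ ; w₆ = w₆ ; colors = colors
    ; distinct = ((_ ∷ _ ∷ w₁≢w₄ ∷ w₁≢w₅ ∷ w₁≢w₆ ∷ []) ∷ (_ ∷ w₂≢w₄ ∷ w₂≢w₅ ∷ w₂≢w₆ ∷ []) ∷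
                  (w₃≢w₄ ∷ w₃≢w₅ ∷ _) ∷ _) , _
    ; edge₁₂ = edge₁₂ ; edge₄₅ = edge₄₅ ; edge₂₃ = edge₂₃ ; edge₅₆ = edge₅₆ ; edge₃₄ = edge₃₄ ; edge₆₁ = edge₆₁ }
    with combine colors w₁ w₅ w₃ | combine colors w₄ w₂ w₆
  ... | x , xi , xj , xk | y , yi , yj , yk = not-resolving
    (stick-≢ s₁₂ (left∈W s₄₅) w₁≢w₄ w₂≢w₄ xi yi)
    (disjoint-sticks-∉ s₁₂ s₅₆ w₁≢w₅ w₁≢w₆ w₂≢w₅ w₂≢w₆ xi xj)
    (disjoint-sticks-∉ s₄₅ s₂₃ (≢-sym w₂≢w₄) (≢-sym w₃≢w₄) (≢-sym w₂≢w₅) (≢-sym w₃≢w₅) yi yj)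
    (covered⇒⊑ colors
      (covered-stick s₁₂ xi (k , trans yk (agree s₆₁)) (j , yj))
      (covered-stick s₅₆ xj (i , trans yi (agree s₄₅)) (k , yk))
      (covered-stick s₃₄ xk (j , trans yj (agree s₂₃)) (i , yi)))
    (covered⇒⊑ colors
      (covered-stick s₄₅ yi (k , trans xk (agree s₃₄)) (j , xj))
      (covered-stick s₂₃ yj (i , trans xi (agree s₁₂)) (k , xk))
      (covered-stick s₆₁ yk (j , trans xj (agree s₅₆)) (i , xi)))
    where
    s₁₂ = Hyperedge⇒Stick edge₁₂
    s₂₃ = Hyperedge⇒Stick edge₂₃
    s₃₄ = Hyperedge⇒Stick edge₃₄
    s₄₅ = Hyperedge⇒Stick edge₄₅
    s₅₆ = Hyperedge⇒Stick edge₅₆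
    s₆₁ = Hyperedge⇒Stick edge₆₁

  -- `x` and `y` take color `k` from the hyperedge of the termini, so all termini are near both. The
  -- sticks at `x` are `u₁u₂` and `v₂v₃`, those at `y` are `v₁v₂` and `u₂u₃`; each apex `u₂`, `v₂`
  -- lies on one stick of either vertex.
  sharkTeeth⇒¬resolving : SharkTeeth G → ¬ IsResolving W
  sharkTeeth⇒¬resolving record
    { i = i ; j = j ; k = k ; u₁ = u₁ ; u₂ = u₂ ; u₃ = u₃ ; v₁ = v₁ ; v₂ = v₂ ; v₃ = v₃
    ; triangle-u = triangle-u ; triangle-v = triangle-v ; disjoint = disjoint
    ; hyperedge = hyperedge ; termini = u₁∈E ∷ u₃∈E ∷ v₁∈E ∷ v₃∈E ∷ [] }
    with combine (Rainbow22Triangle.colors triangle-u) u₁ v₂ u₁ | combine (Rainbow22Triangle.colors triangle-u) v₁ u₂ u₁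
  ... | x , xi , xj , xk | y , yi , yj , yk = not-resolving
    (stick-≢ su₁₂ (left∈W sv₁₂) (apart first first) (apart second first) xi yi)
    (disjoint-sticks-∉ su₁₂ sv₂₃ (apart first second) (apart first third) (apart second second) (apart second third) xi xj)
    (disjoint-sticks-∉ sv₁₂ su₂₃ (≢-sym (apart second first)) (≢-sym (apart third first))
                       (≢-sym (apart second second)) (≢-sym (apart third second)) yi yj)
    (covered⇒⊑ (Rainbow22Triangle.colors triangle-u)
      (covered-stick su₁₂ xi (k , yk) (j , yj))
      (covered-stick sv₂₃ xj (i , trans yi (agree sv₁₂)) (k , trans yk (hyperedge-agree hyperedge u₁∈E v₃∈E)))
      (covered-agree x≈ᵏy))
    (covered⇒⊑ (Rainbow22Triangle.colors triangle-u)
      (covered-stick sv₁₂ yi (k , trans xk (hyperedge-agree hyperedge u₁∈E v₁∈E)) (j , xj))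
      (covered-stick su₂₃ yj (i , trans xi (agree su₁₂)) (k , trans xk (hyperedge-agree hyperedge u₁∈E u₃∈E)))
      (covered-agree (sym x≈ᵏy)))
    where
    su₁₂ = Hyperedge⇒Stick (Rainbow22Triangle.edge₁₂ triangle-u)
    su₂₃ = Hyperedge⇒Stick (Rainbow22Triangle.edge₂₃ triangle-u)
    sv₁₂ = Hyperedge⇒Stick (Rainbow22Triangle.edge₁₂ triangle-v)
    sv₂₃ = Hyperedge⇒Stick (Rainbow22Triangle.edge₂₃ triangle-v)
    x≈ᵏy : x ≈[ k ] y
    x≈ᵏy = trans xk (sym yk)
    first : ∀ {a b c : Vertex} → a List.∈ a ∷ b ∷ c ∷ []
    first = here refl
    second : ∀ {a b c : Vertex} → b List.∈ a ∷ b ∷ c ∷ []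
    second = there (here refl)
    third : ∀ {a b c : Vertex} → c List.∈ a ∷ b ∷ c ∷ []
    third = there (there (here refl))
    apart : u List.∈ u₁ ∷ u₂ ∷ u₃ ∷ [] → v List.∈ v₁ ∷ v₂ ∷ v₃ ∷ [] → u ≢ v
    apart p q refl = disjoint (p , q)

  -- Unresolved pairs produce configurations

  -- Each end is named after the color in which it meets `y`; this orientation determines how sticks
  -- are glued. The names are positional: in a `Split j k i`, `end-k` meets `y` in color `i`.
  record Split (i j k : Color) (x y : Vertex) : Set where
    constructor split
    field
      {end-j end-k} : Vertex
      edge    : Stick i end-j end-k
      ends≢   : end-j ≢ end-k
      at-i    : x ≈[ i ] end-j
      at-j    : y ≈[ j ] end-j
      at-k    : y ≈[ k ] end-k

    at-i′ : x ≈[ i ] end-k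
    at-i′ = trans at-i (agree edge)

  open Split

  -- Color `i` cannot cover, since `x` and `y` differ there. Two landmarks of the slice covered
  -- through the same color agree in two colors and coincide; as the slice has at least two
  -- elements, each of `j` and `k` covers exactly one.
  slice-splits : AllColors i j k → ¬ x ≈[ i ] y → x ⊑ y → Split i j k x y
  slice-splits {i} {j} {k} {x} {y} colors@(i≢j , j≢k , i≢k) x≉y x⊑y with two-in-slice i x
  ... | p , q , p≢q , (p∈W , x≈p) , (q∈W , x≈q) = result (cover p∈W x≈p) (cover q∈W x≈q)
    where
    cover : w ∈ W → x ≈[ i ] w → y ≈[ j ] w ⊎ y ≈[ k ] w
    cover w∈W x≈w with x⊑y w∈W (i , x≈w)
    ... | l , y≈w with color-cases colors l
    ... | inj₁ refl        = contradiction (trans x≈w (sym y≈w)) x≉y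
    ... | inj₂ (inj₁ refl) = inj₁ y≈w
    ... | inj₂ (inj₂ refl) = inj₂ y≈w

    collide : ∀ {l} → i ≢ l → u ∈ W → v ∈ W → x ≈[ i ] u → x ≈[ i ] v → y ≈[ l ] u → y ≈[ l ] v → u ≡ v
    collide i≢l u∈W v∈W x≈u x≈v y≈u y≈v =
      landmark-unique i≢l u∈W v∈W (trans (sym x≈u) x≈v) (trans (sym y≈u) y≈v)

    build : u ∈ W → v ∈ W → u ≢ v → x ≈[ i ] u → x ≈[ i ] v → y ≈[ j ] u → y ≈[ k ] v → Split i j k x y
    build {u} {v} u∈W v∈W u≢v x≈u x≈v y≈u y≈v =
      split (stick u∈W v∈W (trans (sym x≈u) x≈v) uv-only) u≢v x≈u y≈u y≈v
      where
      -- Any further landmark would be covered through `j` or `k`, and so collides with `u` or `v`.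
      uv-only : w ∈ W → u ≈[ i ] w → w ≡ u ⊎ w ≡ v
      uv-only w∈W u≈w with cover w∈W (trans x≈u u≈w)
      ... | inj₁ y≈w = inj₁ (collide i≢j w∈W u∈W (trans x≈u u≈w) x≈u y≈w y≈u)
      ... | inj₂ y≈w = inj₂ (collide i≢k w∈W v∈W (trans x≈u u≈w) x≈v y≈w y≈v)

    result : y ≈[ j ] p ⊎ y ≈[ k ] p → y ≈[ j ] q ⊎ y ≈[ k ] q → Split i j k x y
    result (inj₁ yp) (inj₁ yq) = contradiction (collide i≢j p∈W q∈W x≈p x≈q yp yq) p≢q
    result (inj₁ yp) (inj₂ yq) = build p∈W q∈W p≢q x≈p x≈q yp yq
    result (inj₂ yp) (inj₁ yq) = build q∈W p∈W (≢-sym p≢q) x≈q x≈p yq yp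
    result (inj₂ yp) (inj₂ yq) = contradiction (collide i≢k p∈W q∈W x≈p x≈q yp yq) p≢q

  separated-by : ∀ l → ¬ x ≈[ l ] y → x ≈[ l ] u → y ≈[ l ] v → u ≢ v
  separated-by _ x≉y x≈u y≈v refl = x≉y (trans x≈u (sym y≈v))

  -- The cycle runs through `end-k s`, `end-j s`, `end-j t`, `end-k t`. As `x` and `y` agree in `j`
  -- and `k`, ends of the same name share that coordinate.
  differ-in-one : AllColors i j k → ¬ x ≈[ i ] y → x ≈[ j ] y → x ≈[ k ] y → x ⊑ y → y ⊑ x → BadFourCycle G
  differ-in-one {i} {j} {k} {x} {y} colors x≉y x≈ʲy x≈ᵏy x⊑y y⊑x = record
    { colors   = colors
    ; distinct = ((≢-sym (ends≢ s) ∷ by-i (at-i′ s) (at-i t) ∷ by-i (at-i′ s) (at-i′ t) ∷ []) ∷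
                  (by-i (at-i s) (at-i t) ∷ by-i (at-i s) (at-i′ t) ∷ []) ∷
                  (ends≢ t ∷ []) ∷ [] ∷ []) ,
                 (right∈W (edge s) ∷ left∈W (edge s) ∷ left∈W (edge t) ∷ right∈W (edge t) ∷ [])
    ; edge₁₂   = Stick⇒Hyperedge (Stick-sym (edge s))
    ; edge₃₄   = Stick⇒Hyperedge (edge t)
    ; common₂₃ = common⁺ (left∈W (edge s)) (left∈W (edge t)) (trans (sym (at-j s)) (trans (sym x≈ʲy) (at-j t)))
    ; common₄₁ = common⁺ (right∈W (edge t)) (right∈W (edge s)) (trans (sym (at-k t)) (trans x≈ᵏy (at-k s)))
    }
    where
    s = slice-splits colors x≉y x⊑y
    t = slice-splits colors (x≉y ∘ sym) y⊑x
    by-i : x ≈[ i ] u → y ≈[ i ] v → u ≢ v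
    by-i = separated-by i x≉y

  -- Besides the triangle, the fields record how its corners meet `x` and `y`; this is what allows
  -- two teeth to be compared and glued.
  record Tooth (i j k : Color) (x y : Vertex) : Set where
    field
      {t₁ t₂ t₃} : Vertex
      triangle   : Rainbow22Triangle G i j k t₁ t₂ t₃
      t₁∈W       : t₁ ∈ W
      t₃∈W       : t₃ ∈ W
      t₁≢t₃      : t₁ ≢ t₃
      x≈t₁       : x ≈[ i ] t₁
      x≈t₂       : x ≈[ i ] t₂
      y≈t₂       : y ≈[ j ] t₂
      y≈t₃       : y ≈[ j ] t₃
      y≈t₁       : y ≈[ k ] t₁
      x≈t₃       : x ≈[ k ] t₃

  tooth : AllColors i j k → ¬ x ≈[ i ] y → ¬ x ≈[ j ] y → x ≈[ k ] y → x ⊑ y → y ⊑ x → Tooth i j k x y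
  tooth {i} {j} {k} {x} {y} colors@(i≢j , j≢k , i≢k) x≉ⁱy x≉ʲy x≈ᵏy x⊑y y⊑x = record
    { triangle = record
      { colors   = colors
      ; distinct = ((≢-sym (ends≢ s) ∷ t₁≢t₃ ∷ []) ∷ (t₂≢t₃ ∷ []) ∷ [] ∷ []) ,
                   (right∈W (edge s) ∷ left∈W (edge s) ∷ right∈W (edge t) ∷ [])
      ; edge₁₂   = Stick⇒Hyperedge (Stick-sym (edge s))
      ; edge₂₃   = Stick⇒Hyperedge edge₂₃
      ; common₁₃ = common⁺ (right∈W (edge s)) (right∈W (edge t)) (trans (sym (at-k s)) (trans (sym x≈ᵏy) (at-k t)))
      }
    ; t₁∈W = right∈W (edge s) ; t₃∈W = right∈W (edge t) ; t₁≢t₃ = t₁≢t₃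
    ; x≈t₁ = at-i′ s ; x≈t₂ = at-i s ; y≈t₂ = at-j s ; y≈t₃ = at-i′ t ; y≈t₁ = at-k s ; x≈t₃ = at-k t
    }
    where
    s = slice-splits colors x≉ⁱy x⊑y
    t = slice-splits (transpose colors) (x≉ʲy ∘ sym) y⊑x
    -- The split `t` has `i` and `j` interchanged, so its `end-j` meets `x` in color `i`. Both ends
    -- thus have the `i`-coordinate of `x` and the `j`-coordinate of `y`.
    apex : end-j t ≡ end-j s
    apex = landmark-unique i≢j (left∈W (edge t)) (left∈W (edge s))
             (trans (sym (at-j t)) (at-i s)) (trans (sym (at-i t)) (at-j s))
    edge₂₃ : Stick j (end-j s) (end-k t)
    edge₂₃ = subst (λ z → Stick j z (end-k t)) apex (edge t)
    t₂≢t₃ : end-j s ≢ end-k t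
    t₂≢t₃ = subst (_≢ end-k t) apex (ends≢ t)
    t₁≢t₃ : end-k s ≢ end-k t
    t₁≢t₃ t₁≡t₃ = t₂≢t₃ (landmark-unique i≢j (left∈W (edge s)) (right∈W (edge t))
      (trans (agree (edge s)) (cong (coord i) t₁≡t₃)) (agree edge₂₃))

  -- The second tooth is the first construction with `x` and `y` exchanged.
  differ-in-two : AllColors i j k → ¬ x ≈[ i ] y → ¬ x ≈[ j ] y → x ≈[ k ] y →
                  x ∉ W → y ∉ W → x ⊑ y → y ⊑ x → SharkTeeth G
  differ-in-two {i} {j} {k} {x} {y} colors x≉ⁱy x≉ʲy x≈ᵏy x∉W y∉W x⊑y y⊑x = record
    { triangle-u = s.triangle
    ; triangle-v = t.triangle
    ; disjoint   = All≢⇒Disjoint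
        ((by-i s.x≈t₁ t.x≈t₁ ∷ by-i s.x≈t₁ t.x≈t₂ ∷ u₁≢v₃ ∷ []) ∷
         (by-i s.x≈t₂ t.x≈t₁ ∷ by-i s.x≈t₂ t.x≈t₂ ∷ by-j s.y≈t₂ t.y≈t₃ ∷ []) ∷
         (u₃≢v₁ ∷ by-j s.y≈t₃ t.y≈t₂ ∷ by-j s.y≈t₃ t.y≈t₃ ∷ []) ∷ [])
    ; hyperedge  = (s.t₁ , u₁∈E) , coord k x , (λ _ → refl)
    -- Three distinct termini suffice.
    ; poofy      = length≤card E ((s.t₁≢t₃ ∷ by-i s.x≈t₁ t.x≈t₁ ∷ []) ∷ (u₃≢v₁ ∷ []) ∷ [] ∷ [])
                                 (u₁∈E ∷ u₃∈E ∷ v₁∈E ∷ [])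
    ; termini    = u₁∈E ∷ u₃∈E ∷ v₁∈E ∷ v₃∈E ∷ []
    }
    where
    module s = Tooth (tooth colors x≉ⁱy x≉ʲy x≈ᵏy x⊑y y⊑x)
    module t = Tooth (tooth colors (x≉ⁱy ∘ sym) (x≉ʲy ∘ sym) (sym x≈ᵏy) y⊑x x⊑y)
    E : VertexSet
    E = slice W k (coord k x)
    u₁∈E : s.t₁ ∈ E
    u₁∈E = ∈-slice⁺ W k s.t₁∈W (sym (trans x≈ᵏy s.y≈t₁))
    u₃∈E : s.t₃ ∈ E
    u₃∈E = ∈-slice⁺ W k s.t₃∈W (sym s.x≈t₃)
    v₁∈E : t.t₁ ∈ E
    v₁∈E = ∈-slice⁺ W k t.t₁∈W (sym t.y≈t₁)
    v₃∈E : t.t₃ ∈ E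
    v₃∈E = ∈-slice⁺ W k t.t₃∈W (sym (trans x≈ᵏy t.x≈t₃))
    by-i : x ≈[ i ] u → y ≈[ i ] v → u ≢ v
    by-i = separated-by i x≉ⁱy
    by-j : y ≈[ j ] u → x ≈[ j ] v → u ≢ v
    by-j = separated-by j (x≉ʲy ∘ sym)
    -- Both corners are attached to `x`, in colors `i` and `j`, so `separated-by` does not apply. If
    -- equal, they would have all coordinates of `x`, which lies outside `W`. For `u₃≢v₁` the same
    -- happens at `y`.
    u₁≢v₃ : s.t₁ ≢ t.t₃
    u₁≢v₃ p = x∉W (subst (_∈ W) (sym (vertex-ext-colors colors s.x≈t₁ (trans t.y≈t₃ (cong (coord j) (sym p))) (trans x≈ᵏy s.y≈t₁))) s.t₁∈W)
    u₃≢v₁ : s.t₃ ≢ t.t₁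
    u₃≢v₁ p = y∉W (subst (_∈ W) (sym (vertex-ext-colors colors (trans t.x≈t₁ (cong (coord i) (sym p))) s.y≈t₃ (trans (sym x≈ᵏy) s.x≈t₃))) s.t₃∈W)

  -- Both landmarks have the `i`-coordinate of `x` and the `j`-coordinate of `y`.
  splits-meet : i ≢ j → (s : Split i j k x y) (t : Split j k i y x) → end-j s ≡ end-k t
  splits-meet i≢j s t = landmark-unique i≢j (left∈W (edge s)) (right∈W (edge t))
    (trans (sym (at-i s)) (at-k t)) (trans (sym (at-j s)) (at-i′ t))

  hex-edge : i ≢ j → (s : Split i j k x y) (t : Split j k i y x) → Stick i (end-k s) (end-k t)
  hex-edge {i} i≢j s t = subst (Stick i (end-k s)) (splits-meet i≢j s t) (Stick-sym (edge s))

  hex-≢ : i ≢ j → (s : Split i j k x y) (t : Split j k i y x) → end-k s ≢ end-k t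
  hex-≢ i≢j s t = subst (end-k s ≢_) (splits-meet i≢j s t) (≢-sym (ends≢ s))

  -- Six splits, in colors `i`, `j`, `k`, `i`, `j`, `k` and alternately at `x` and `y`, each meet
  -- the next by `splits-meet` and close up cyclically. The corners are their `end-k`; consecutive
  -- ones are distinct as ends of a stick, the others by a color in which `x` and `y` differ.
  differ-in-three : AllColors i j k → ¬ x ≈[ i ] y → ¬ x ≈[ j ] y → ¬ x ≈[ k ] y → x ⊑ y → y ⊑ x → PlainHex G
  differ-in-three {i} {j} {k} {x} {y} colors@(i≢j , j≢k , i≢k) x≉ⁱy x≉ʲy x≉ᵏy x⊑y y⊑x = record
    { colors   = colors
    ; distinct =
        ((hex-≢ i≢j s₁ s₂ ∷ ≢-sym (by-k (at-i′ s₃) (at-k s₁)) ∷ by-i (at-i′ s₁) (at-i′ s₄) ∷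
          by-i (at-i′ s₁) (at-k s₅) ∷ ≢-sym (hex-≢ (≢-sym i≢k) s₆ s₁) ∷ []) ∷
         (hex-≢ j≢k s₂ s₃ ∷ by-i (at-k s₂) (at-i′ s₄) ∷ ≢-sym (by-j (at-i′ s₅) (at-i′ s₂)) ∷
          ≢-sym (by-j (at-k s₆) (at-i′ s₂)) ∷ []) ∷
         (hex-≢ (≢-sym i≢k) s₃ s₄ ∷ ≢-sym (by-j (at-i′ s₅) (at-k s₃)) ∷ by-k (at-i′ s₃) (at-i′ s₆) ∷ []) ∷
         (hex-≢ i≢j s₄ s₅ ∷ by-k (at-k s₄) (at-i′ s₆) ∷ []) ∷
         (hex-≢ j≢k s₅ s₆ ∷ []) ∷ [] ∷ []) ,
        (right∈W (edge s₁) ∷ right∈W (edge s₂) ∷ right∈W (edge s₃) ∷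
         right∈W (edge s₄) ∷ right∈W (edge s₅) ∷ right∈W (edge s₆) ∷ [])
    ; edge₁₂   = Stick⇒Hyperedge (hex-edge i≢j s₁ s₂)
    ; edge₄₅   = Stick⇒Hyperedge (hex-edge i≢j s₄ s₅)
    ; edge₂₃   = Stick⇒Hyperedge (hex-edge j≢k s₂ s₃)
    ; edge₅₆   = Stick⇒Hyperedge (hex-edge j≢k s₅ s₆)
    ; edge₃₄   = Stick⇒Hyperedge (hex-edge (≢-sym i≢k) s₃ s₄)
    ; edge₆₁   = Stick⇒Hyperedge (hex-edge (≢-sym i≢k) s₆ s₁)
    }
    where
    s₁ = slice-splits colors x≉ⁱy x⊑y
    s₂ = slice-splits (rotate colors) (x≉ʲy ∘ sym) y⊑x
    s₃ = slice-splits (rotate (rotate colors)) x≉ᵏy x⊑y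
    s₄ = slice-splits colors (x≉ⁱy ∘ sym) y⊑x
    s₅ = slice-splits (rotate colors) x≉ʲy x⊑y
    s₆ = slice-splits (rotate (rotate colors)) (x≉ᵏy ∘ sym) y⊑x
    by-i : x ≈[ i ] u → y ≈[ i ] v → u ≢ v
    by-i = separated-by i x≉ⁱy
    by-j : x ≈[ j ] u → y ≈[ j ] v → u ≢ v
    by-j = separated-by j x≉ʲy
    by-k : x ≈[ k ] u → y ≈[ k ] v → u ≢ v
    by-k = separated-by k x≉ᵏy

  unresolved⇒configuration : x ≢ y → x ∉ W → y ∉ W → x ⊑ y → y ⊑ x → BadFourCycle G ⊎ PlainHex G ⊎ SharkTeeth G
  unresolved⇒configuration {x} {y} x≢y x∉W y∉W p q
    with coord 0F x ≟ coord 0F y | coord 1F x ≟ coord 1F y | coord 2F x ≟ coord 2F y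
  ... | yes a | yes b | yes c = contradiction (vertex-ext λ { 0F → a ; 1F → b ; 2F → c }) x≢y
  -- In each case the colors are ordered with the differing ones first.
  ... | no  a | yes b | yes c = inj₁ (differ-in-one {0F} {1F} {2F} {x} {y} ((λ ()) , (λ ()) , (λ ())) a b c p q)
  ... | yes a | no  b | yes c = inj₁ (differ-in-one {1F} {0F} {2F} {x} {y} ((λ ()) , (λ ()) , (λ ())) b a c p q)
  ... | yes a | yes b | no  c = inj₁ (differ-in-one {2F} {0F} {1F} {x} {y} ((λ ()) , (λ ()) , (λ ())) c a b p q)
  ... | no  a | no  b | no  c = inj₂ (inj₁ (differ-in-three {0F} {1F} {2F} {x} {y} ((λ ()) , (λ ()) , (λ ())) a b c p q))
  ... | no  a | no  b | yes c = inj₂ (inj₂ (differ-in-two {0F} {1F} {2F} {x} {y} ((λ ()) , (λ ()) , (λ ())) a b c x∉W y∉W p q))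
  ... | no  a | yes b | no  c = inj₂ (inj₂ (differ-in-two {0F} {2F} {1F} {x} {y} ((λ ()) , (λ ()) , (λ ())) a c b x∉W y∉W p q))
  ... | yes a | no  b | no  c = inj₂ (inj₂ (differ-in-two {1F} {2F} {0F} {x} {y} ((λ ()) , (λ ()) , (λ ())) b c a x∉W y∉W p q))

mainTheorem2 : (n : Color → ℕ) → 3 ≤ n 0F → 3 ≤ n 1F → n 0F ≤ n 2F → n 1F ≤ n 2F →
    let open LandmarkSystems n in
    (W : VertexSet) → IsBasicLandmarkSystem W →
    IsResolving W ⇔
    (¬ BadFourCycle (landmarkGraph W) × ¬ PlainHex (landmarkGraph W) × ¬ SharkTeeth (landmarkGraph W))
mainTheorem2 n n₀≥3 n₁≥3 n₀≤n₂ _ W basic = mk⇔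
  (λ res → (λ c → fourCycle⇒¬resolving c res) , (λ h → hex⇒¬resolving h res) , (λ t → sharkTeeth⇒¬resolving t res))
  (λ (¬c , ¬h , ¬t) → resolving λ x y x≢y x∉W y∉W x⊑y y⊑x →
    [ ¬c , [ ¬h , ¬t ] ] (unresolved⇒configuration x≢y x∉W y∉W x⊑y y⊑x))
  where
  n≥3 : ∀ i → 3 ≤ n i
  n≥3 0F = n₀≥3
  n≥3 1F = n₁≥3
  n≥3 2F = ≤-trans n₀≥3 n₀≤n₂
  open Landmarks n n≥3 W basic
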